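{- The number of parking completions of $\mathbf{t}=(t_1,\dots,t_m)$ in $[n]$ is \[ \big|\mathrm{PC}_n(\mathbf{t})\big|=\sum_{\boldsymbol\ell\in L_n(\mathbf{t})} \binom{n-m}{\boldsymbol\ell}\prod_{j=1}^{m+1}(\ell_j+1)^{(\ell_j-1)}, \] where \[L_n(\mathbf{t})= \left\{\boldsymbol\ell=(\ell_1,\dots,\ell_{m+1})\in\mathbb{N}^{m+1}\,\middle\vert \begin{array}{l} \ell_1+\cdots+\ell_j \geq t_j-j \text{ for all } j\in[m], \text{ and}\\ \ell_1+\cdots+\ell_{m+1}=n-m \end{array} \right\}.\]
   Context: Let $[n]=\{1,\dots,n\}$ and $\mathbb{N}=\{0,1,2,\dots\}$. A parking function of length $n$ is a sequence $\mathbf{c}=(c_1,\dots,c_n)\in[n]^n$ such that there is a permutation $\sigma$ of $[n]$ with $c_{\sigma(i)}\le i$ for all $i$. Let $\mathbf{t}=(t_1,\dots,t_m)$ be a strictly increasing list of elements of $[n]$ (the taken spots) and let $\mathbf{u}=(u_1,\dots,u_{n-m})$ be the elements of $[n]\setminus\{t_1,\dots,t_m\}$ in increasing order. An increasing parking completion of $\mathbf{t}$ is a weakly increasing sequence $(c_1,\dots,c_{n-m})\in[n]^{n-m}$ with $c_i\le u_i$ for all $i$ (equivalently, $(t_1,\dots,t_m,c_1,\dots,c_{n-m})$ is a parking function). A parking completion of $\mathbf{t}$ in $[n]$ is a sequence in $[n]^{n-m}$ whose weakly increasing rearrangement is an increasing parking completion; $\mathrm{PC}_n(\mathbf{t})$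 denotes the set of parking completions of $\mathbf{t}$ in $[n]$. Here $\binom{n-m}{\boldsymbol\ell}=\frac{(n-m)!}{\ell_1!\cdots\ell_{m+1}!}$ is the multinomial coefficient. -}

module Defs where

open import Data.Nat using (ℕ; zero; suc; _+_; _*_; _∸_; _^_; _≤_; _<_; _≤?_; _!; _/_; NonZero)
open import Data.Nat.Properties using (_!≢0; m*n≢0; ≤-decTotalOrder; _≟_)
open import Data.List using (List; []; _∷_; map; concatMap; filter; length; take; upTo; foldr)
open import Data.Nat.ListAction using (sum; product)
open import Data.List.Relation.Unary.All using (All; all?)
open import Data.List.Relation.Unary.Linked using (Linked; linked?)
open import Data.List.Relation.Binary.Pointwise using (Pointwise)
import Data.List.Relation.Binary.Pointwise as PW
open import Data.List.Membership.DecPropositional _≟_ using (_∈?_)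
open import Data.List.Sort ≤-decTotalOrder using (sort)
open import Data.Vec using (Vec; toList; lookup)
open import Data.Fin using (Fin; toℕ)
import Data.Fin.Properties as FinP
open import Data.Product using (_×_)
open import Relation.Nullary using (Dec; ¬?)
open import Relation.Nullary.Decidable using (_×-dec_)

range : ℕ → List ℕ
range n = map suc (upTo n)

seqs : ℕ → ℕ → List (List ℕ)
seqs n zero    = [] ∷ []
seqs n (suc k) = concatMap (λ x → map (x ∷_) (seqs n k)) (range n)

freeSpots : ℕ → List ℕ → List ℕ
freeSpots n t = filter (λ x → ¬? (x ∈? t)) (range n)

-- increasing parking completion of t in [n]:
-- weakly increasing, entries ≥ 1, and c_i ≤ u_i pointwise (forces length n - m)
IsIncPC : ℕ → List ℕ → List ℕ → Set
IsIncPC n t c = Linked _≤_ c × All (1 ≤_) c × Pointwise _≤_ c (freeSpots n t)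

isIncPC? : ∀ n t c → Dec (IsIncPC n t c)
isIncPC? n t c =
  linked? _≤?_ c ×-dec all? (1 ≤?_) c ×-dec PW.decidable _≤?_ c (freeSpots n t)

IsPC : ℕ → List ℕ → List ℕ → Set
IsPC n t c = IsIncPC n t (sort c)

isPC? : ∀ n t c → Dec (IsPC n t c)
isPC? n t c = isIncPC? n t (sort c)

PC : (n m : ℕ) → Vec ℕ m → List (List ℕ)
PC n m t = filter (isPC? n (toList t)) (seqs n (n ∸ m))

comps : ℕ → ℕ → List (List ℕ)
comps zero    zero    = [] ∷ []
comps zero    (suc s) = []
comps (suc p) s       = concatMap (λ a → map (a ∷_) (comps p (s ∸ a))) (upTo (suc s))

-- condition of L_n(t): ℓ_1 + … + ℓ_j ≥ t_j − j for all j ∈ [m]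
-- (written as t_j ≤ ℓ_1 + … + ℓ_j + j, avoiding truncated subtraction)
InL : (m : ℕ) → Vec ℕ m → List ℕ → Set
InL m t ℓ = (j : Fin m) → lookup t j ≤ sum (take (suc (toℕ j)) ℓ) + suc (toℕ j)

inL? : ∀ m t ℓ → Dec (InL m t ℓ)
inL? m t ℓ = FinP.all? (λ j → lookup t j ≤? sum (take (suc (toℕ j)) ℓ) + suc (toℕ j))

Lset : (n m : ℕ) → Vec ℕ m → List (List ℕ)
Lset n m t = filter (inL? m t) (comps (suc m) (n ∸ m))

prodFact : List ℕ → ℕ
prodFact ℓ = product (map _! ℓ)

prodFact≢0 : ∀ ℓ → NonZero (prodFact ℓ)
prodFact≢0 []      = _
prodFact≢0 (x ∷ ℓ) = m*n≢0 (x !) (prodFact ℓ) {{x !≢0}} {{prodFact≢0 ℓ}}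

multinomial : ℕ → List ℕ → ℕ
multinomial N ℓ = (N ! / prodFact ℓ) {{prodFact≢0 ℓ}}

-- ∏_j (ℓ_j + 1)^(ℓ_j − 1)   (for ℓ_j = 0 the factor is 1^(-1) = 1 = 1^0)
pfProd : List ℕ → ℕ
pfProd ℓ = product (map (λ a → suc a ^ (a ∸ 1)) ℓ)

rhs : (n m : ℕ) → Vec ℕ m → ℕ
rhs n m t = sum (map (λ ℓ → multinomial (n ∸ m) ℓ * pfProd ℓ) (Lset n m t))

{-# OPTIONS --safe #-}

-- Let a be the number of free spots in [k] and let H(N) count the sequences over [k] of length N
-- that meet the counting conditions #{c_i ≤ k'} ≥ #{free spots ≤ k'} for k' ≤ k. Then, for a
-- function f depending only on the taken spots t_1 < … < t_j in [k],
--   H(N) = Σ_{i ≥ a} (N choose i) f(i) (a - i - 1)^(N - i)   over ℤ.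
-- For k = 0 this is Abel's identity Σ_i (N choose i) (i+1)^(i-1) (y - i - 1)^(N-i) = y^N at y = 0.
-- Adding a spot sums over the positions of the new value, which by the binomial theorem raises the
-- base by one; for a free spot f is kept, and for a taken spot Abel's identity turns the
-- result back into the same shape with f replaced by the binomial convolution of its truncation
-- to i ≥ a = t_{j+1} - (j+1) with (i+1)^(i-1). At N = a the sum collapses to H(a) = f(a), and the
-- iterated truncated convolution is the sum over L_n(t).
module Submission where

open import Defs
open import Algebra.Core using (Op₂)
open import Algebra.Bundles using (CommutativeSemigroup)
import Algebra.Properties.CommutativeSemigroup as CommutativeSemigroupProperties
open import Algebra.Structures using (IsCommutativeSemiring; IsCommutativeMonoid)
open import Data.Bool using (if_then_else_; true; false)
open import Data.Fin as Fin using (toℕ)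
open import Data.Integer as ℤ using (ℤ; +_; 0ℤ; 1ℤ; -1ℤ)
  renaming (_+_ to _⊕_; _*_ to _⊗_; _-_ to _⊝_; _^_ to _**_; -_ to neg)
import Data.Integer.Properties as ℤ
import Data.Integer.Tactic.RingSolver as ℤ-Solver
open import Data.List using
  (List; []; _∷_; _++_; _∷ʳ_; map; concatMap; filter; length; upTo; applyUpTo; take; foldl)
open import Data.List.Properties using
  (map-cong; map-cong-local; map-∘; map-++; map-upTo; filter-++; filter-all; filter-none;
   filter-accept; filter-reject; length-filter; length-++; upTo-∷ʳ; applyUpTo-∷ʳ; foldl-∷ʳ; ++-identityʳ)
open import Data.List.Membership.Propositional using (_∈_; _∉_)
open import Data.List.Relation.Binary.Permutation.Propositional using (_↭_; ↭-sym)
import Data.List.Relation.Binary.Permutation.Propositional.Properties as Perm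
open import Data.List.Relation.Binary.Pointwise using (Pointwise; []; _∷_)
open import Data.List.Relation.Unary.All as All using (All; []; _∷_)
import Data.List.Relation.Unary.All.Properties as All
open import Data.List.Relation.Unary.AllPairs using (AllPairs; []; _∷_)
import Data.List.Relation.Unary.AllPairs.Properties as AllPairs
open import Data.List.Relation.Unary.Any using (here; there)
open import Data.List.Relation.Unary.Linked using (Linked)
open import Data.List.Relation.Unary.Linked.Properties using (Linked⇒AllPairs)
open import Data.Nat using
  (ℕ; zero; suc; _+_; _*_; _∸_; _^_; _!; _≤_; _<_; _≤?_; z≤n; s≤s; s≤s⁻¹; s<s⁻¹)
open import Data.Nat.Combinatorics using
  (_C_; nCk+nC[k+1]≡[n+1]C[k+1]; nCk≡n!/k![n-k]!; k![n∸k]!∣n!; k>n⇒nCk≡0)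
open import Data.Nat.Divisibility using (_∣_; ∣-trans; *-monoʳ-∣; ∣-refl)
open import Data.Nat.DivMod using (m*n/n≡m; m/n*n≡m; /-congˡ)
open import Data.Nat.ListAction using (sum)
open import Data.Nat.ListAction.Properties using (sum-++; sum-↭)
open import Data.Nat.Properties
open import Data.Nat.Tactic.RingSolver using (solve-∀)
open import Data.List.Membership.DecPropositional _≟_ using (_∈?_)
open import Data.List.Sort ≤-decTotalOrder using (sort-↭; sort-↗)
open import Data.Product using (_×_; _,_; proj₁; proj₂)
open import Data.Sum using (inj₁; inj₂)
open import Data.Unit using (⊤; tt)
open import Data.Vec as Vec using (Vec; toList; lookup)
open import Data.Vec.Properties using (length-toList)
open import Function using (_∘_; id; _⇔_; mk⇔)
open import Level using (0ℓ)
open import Relation.Binary.Definitions using (tri<; tri≈; tri>)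
open import Relation.Binary.PropositionalEquality
open import Relation.Nullary using (Dec; yes; no; ¬_; ¬?; does; contradiction)
open import Relation.Nullary.Decidable using (_×-dec_; dec-true; dec-false; does-⇔)
open import Relation.Unary using (Decidable)

open ≡-Reasoning

-- Binomial sums over a commutative semiring

module BinomialSum {A : Set} {_⊕_ _⊗_ : Op₂ A} {0# 1# : A}
                   (isCommutativeSemiring : IsCommutativeSemiring _≡_ _⊕_ _⊗_ 0# 1#) where

  open IsCommutativeSemiring isCommutativeSemiring
    using (+-isCommutativeMonoid; distribˡ; distribʳ)
    renaming (+-assoc to ⊕-assoc; +-identityˡ to ⊕-identityˡ; +-identityʳ to ⊕-identityʳ)

  ⊕-commutativeSemigroup : CommutativeSemigroup 0ℓ 0ℓ
  ⊕-commutativeSemigroup = record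
    { isCommutativeSemigroup = IsCommutativeMonoid.isCommutativeSemigroup +-isCommutativeMonoid }

  open CommutativeSemigroupProperties ⊕-commutativeSemigroup using (interchange)

  -- Σ_{i+j=n} (n choose i) h i j, in the form given by Pascal's rule.
  bsum : ℕ → (ℕ → ℕ → A) → A
  bsum zero    h = h 0 0
  bsum (suc n) h = bsum n (λ i j → h (suc i) j) ⊕ bsum n (λ i j → h i (suc j))

  bsum-cong : ∀ n {g h} → (∀ i j → i + j ≡ n → g i j ≡ h i j) → bsum n g ≡ bsum n h
  bsum-cong zero    eq = eq 0 0 refl
  bsum-cong (suc n) eq = cong₂ _⊕_
    (bsum-cong n λ i j p → eq (suc i) j (cong suc p))
    (bsum-cong n λ i j p → eq i (suc j) (trans (+-suc i j) (cong suc p)))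

  bsum-+ : ∀ n g h → bsum n (λ i j → g i j ⊕ h i j) ≡ bsum n g ⊕ bsum n h
  bsum-+ zero    g h = refl
  bsum-+ (suc n) g h = trans (cong₂ _⊕_ (bsum-+ n _ _) (bsum-+ n _ _)) (interchange _ _ _ _)

  bsum-*ˡ : ∀ n c h → bsum n (λ i j → c ⊗ h i j) ≡ c ⊗ bsum n h
  bsum-*ˡ zero    c h = refl
  bsum-*ˡ (suc n) c h = trans (cong₂ _⊕_ (bsum-*ˡ n c _) (bsum-*ˡ n c _)) (sym (distribˡ c _ _))

  bsum-*ʳ : ∀ n h c → bsum n (λ i j → h i j ⊗ c) ≡ bsum n h ⊗ c
  bsum-*ʳ zero    h c = refl
  bsum-*ʳ (suc n) h c = trans (cong₂ _⊕_ (bsum-*ʳ n _ c) (bsum-*ʳ n _ c)) (sym (distribʳ c _ _))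

  -- Both sides run over a + b + j = n with the trinomial coefficient n!/(a! b! j!). The induction
  -- splits by which of the three indices receives the new element.
  bsum-assoc : ∀ n (h : ℕ → ℕ → ℕ → A) →
    bsum n (λ i j → bsum i (λ a b → h a b j)) ≡ bsum n (λ a k → bsum k (λ b j → h a b j))
  bsum-assoc zero    h = refl
  bsum-assoc (suc n) h = begin
    bsum n (λ i j → bsum i (λ a b → h (suc a) b j) ⊕ bsum i (λ a b → h a (suc b) j))
      ⊕ bsum n (λ i j → bsum i (λ a b → h a b (suc j)))
      ≡⟨ cong₂ _⊕_
           (trans (bsum-+ n _ _) (cong₂ _⊕_ (bsum-assoc n _) (bsum-assoc n _)))
           (bsum-assoc n _) ⟩
    (bsum n (λ a k → bsum k (λ b j → h (suc a) b j))
      ⊕ bsum n (λ a k → bsum k (λ b j → h a (suc b) j)))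
      ⊕ bsum n (λ a k → bsum k (λ b j → h a b (suc j)))
      ≡⟨ ⊕-assoc _ _ _ ⟩
    bsum n (λ a k → bsum k (λ b j → h (suc a) b j))
      ⊕ (bsum n (λ a k → bsum k (λ b j → h a (suc b) j))
      ⊕ bsum n (λ a k → bsum k (λ b j → h a b (suc j))))
      ≡⟨ cong (bsum n (λ a k → bsum k (λ b j → h (suc a) b j)) ⊕_) (bsum-+ n _ _) ⟨
    bsum (suc n) (λ a k → bsum k (λ b j → h a b j)) ∎

  bsum-zero : ∀ n {h} → (∀ i j → i + j ≡ n → h i j ≡ 0#) → bsum n h ≡ 0#
  bsum-zero zero    h≡0 = h≡0 0 0 refl
  bsum-zero (suc n) h≡0 = trans
    (cong₂ _⊕_
      (bsum-zero n λ i j p → h≡0 (suc i) j (cong suc p))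
      (bsum-zero n λ i j p → h≡0 i (suc j) (trans (+-suc i j) (cong suc p))))
    (⊕-identityˡ 0#)

  bsum-last : ∀ n h → (∀ i j → i + suc j ≡ n → h i (suc j) ≡ 0#) → bsum n h ≡ h n 0
  bsum-last zero    h h≡0 = refl
  bsum-last (suc n) h h≡0 = trans
    (cong₂ _⊕_
      (bsum-last n _ λ i j p → h≡0 (suc i) j (cong suc p))
      (bsum-zero n λ i j p → h≡0 i j (trans (+-suc i j) (cong suc p))))
    (⊕-identityʳ _)

  bsum-first : ∀ n h → (∀ i j → suc i + j ≡ n → h (suc i) j ≡ 0#) → bsum n h ≡ h 0 n
  bsum-first zero    h h≡0 = refl
  bsum-first (suc n) h h≡0 = trans
    (cong₂ _⊕_
      (bsum-zero n λ i j p → h≡0 i j (cong suc p))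
      (bsum-first n _ λ i j p → h≡0 i (suc j) (cong suc (trans (+-suc i j) p))))
    (⊕-identityˡ _)

open BinomialSum +-*-isCommutativeSemiring
module ℤΣ = BinomialSum ℤ.+-*-isCommutativeSemiring
open ℤΣ using () renaming (bsum to ∑)

-- Abel's identity

pos-bsum : ∀ n h → + bsum n h ≡ ∑ n (λ i j → + h i j)
pos-bsum zero    h = refl
pos-bsum (suc n) h = trans (ℤ.pos-+ (bsum n _) _) (cong₂ _⊕_ (pos-bsum n _) (pos-bsum n _))

pos-^ : ∀ m n → + (m ^ n) ≡ (+ m) ** n
pos-^ m zero    = refl
pos-^ m (suc n) = trans (ℤ.pos-* m (m ^ n)) (cong (+ m ⊗_) (pos-^ m n))

binomial-theorem : ∀ n x y → ∑ n (λ i j → x ** i ⊗ y ** j) ≡ (x ⊕ y) ** n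
binomial-theorem zero    x y = refl
binomial-theorem (suc n) x y = begin
  ∑ n (λ i j → x ⊗ x ** i ⊗ y ** j) ⊕ ∑ n (λ i j → x ** i ⊗ (y ⊗ y ** j))
    ≡⟨ cong₂ _⊕_ (ℤΣ.bsum-cong n λ i j _ → ℤ.*-assoc x _ _)
                 (ℤΣ.bsum-cong n λ i j _ → swap (x ** i) y (y ** j)) ⟩
  ∑ n (λ i j → x ⊗ (x ** i ⊗ y ** j)) ⊕ ∑ n (λ i j → y ⊗ (x ** i ⊗ y ** j))
    ≡⟨ cong₂ _⊕_ (ℤΣ.bsum-*ˡ n x _) (ℤΣ.bsum-*ˡ n y _) ⟩
  x ⊗ ∑ n (λ i j → x ** i ⊗ y ** j) ⊕ y ⊗ ∑ n (λ i j → x ** i ⊗ y ** j)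
    ≡⟨ ℤ.*-distribʳ-+ _ x y ⟨
  (x ⊕ y) ⊗ ∑ n (λ i j → x ** i ⊗ y ** j)
    ≡⟨ cong ((x ⊕ y) ⊗_) (binomial-theorem n x y) ⟩
  (x ⊕ y) ⊗ (x ⊕ y) ** n ∎
  where
  swap : ∀ a b c → a ⊗ (b ⊗ c) ≡ b ⊗ (a ⊗ c)
  swap = ℤ-Solver.solve-∀

-- i (q+1 choose i) = (q+1) (q choose i-1)
bsum-absorb : ∀ q h → ∑ (suc q) (λ i j → + i ⊗ h i j) ≡ + suc q ⊗ ∑ q (λ i j → h (suc i) j)
bsum-absorb zero h = lem (h 1 0) (h 0 1)
  where
  lem : ∀ x y → 1ℤ ⊗ x ⊕ 0ℤ ⊗ y ≡ 1ℤ ⊗ x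
  lem = ℤ-Solver.solve-∀
bsum-absorb (suc q) h = begin
  ∑ (suc q) (λ i j → + suc i ⊗ h₁ i j) ⊕ ∑ (suc q) (λ i j → + i ⊗ h₂ i j)
    ≡⟨ cong₂ _⊕_ shift (bsum-absorb q h₂) ⟩
  (S ⊕ + suc q ⊗ S₁) ⊕ + suc q ⊗ S₂
    ≡⟨ lem (+ suc q) S₁ S₂ ⟩
  ℤ.suc (+ suc q) ⊗ S ∎
  where
  h₁ h₂ : ℕ → ℕ → ℤ
  h₁ i j = h (suc i) j
  h₂ i j = h i (suc j)
  S₁ S₂ S : ℤ
  S₁ = ∑ q (λ i j → h₁ (suc i) j)
  S₂ = ∑ q (λ i j → h₂ (suc i) j)
  S  = S₁ ⊕ S₂
  shift : ∑ (suc q) (λ i j → + suc i ⊗ h₁ i j) ≡ S ⊕ + suc q ⊗ S₁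
  shift = begin
    ∑ (suc q) (λ i j → + suc i ⊗ h₁ i j)
      ≡⟨ ℤΣ.bsum-cong (suc q) {λ i j → + suc i ⊗ h₁ i j} {λ i j → h₁ i j ⊕ + i ⊗ h₁ i j}
           (λ i j _ → ℤ.suc-* (+ i) (h₁ i j)) ⟩
    ∑ (suc q) (λ i j → h₁ i j ⊕ + i ⊗ h₁ i j)
      ≡⟨ ℤΣ.bsum-+ (suc q) h₁ (λ i j → + i ⊗ h₁ i j) ⟩
    S ⊕ ∑ (suc q) (λ i j → + i ⊗ h₁ i j)
      ≡⟨ cong (S ⊕_) (bsum-absorb q h₁) ⟩
    S ⊕ + suc q ⊗ S₁ ∎
  lem : ∀ c x y → ((x ⊕ y) ⊕ c ⊗ x) ⊕ c ⊗ y ≡ (1ℤ ⊕ c) ⊗ (x ⊕ y)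
  lem = ℤ-Solver.solve-∀

-- A finite difference of order q annihilates a polynomial of degree p < q. One factor c + i is
-- split: the c part has lower degree, while absorption in the i part lowers q and shifts c by one.
alternating-power-sum : ∀ {p q} → p < q → ∀ c → ∑ q (λ i j → -1ℤ ** j ⊗ (c ⊕ + i) ** p) ≡ 0ℤ
alternating-power-sum {zero} {suc q} _ c = begin
  ∑ (suc q) (λ i j → -1ℤ ** j ⊗ 1ℤ)
    ≡⟨ ℤΣ.bsum-cong (suc q) {λ i j → -1ℤ ** j ⊗ 1ℤ} {λ i j → 1ℤ ** i ⊗ -1ℤ ** j}
         (λ i j _ → trans (ℤ.*-comm (-1ℤ ** j) 1ℤ) (cong (_⊗ -1ℤ ** j) (sym (ℤ.^-zeroˡ i)))) ⟩
  ∑ (suc q) (λ i j → 1ℤ ** i ⊗ -1ℤ ** j)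
    ≡⟨ binomial-theorem (suc q) 1ℤ -1ℤ ⟩
  0ℤ ∎
alternating-power-sum {suc p} {suc q} p<q c = begin
  ∑ (suc q) (λ i j → -1ℤ ** j ⊗ ((c ⊕ + i) ⊗ (c ⊕ + i) ** p))
    ≡⟨ ℤΣ.bsum-cong (suc q) {λ i j → -1ℤ ** j ⊗ ((c ⊕ + i) ⊗ (c ⊕ + i) ** p)}
         {λ i j → c ⊗ h i j ⊕ + i ⊗ h i j}
         (λ i j _ → split (-1ℤ ** j) c (+ i) ((c ⊕ + i) ** p)) ⟩
  ∑ (suc q) (λ i j → c ⊗ h i j ⊕ + i ⊗ h i j)
    ≡⟨ ℤΣ.bsum-+ (suc q) (λ i j → c ⊗ h i j) (λ i j → + i ⊗ h i j) ⟩
  ∑ (suc q) (λ i j → c ⊗ h i j) ⊕ ∑ (suc q) (λ i j → + i ⊗ h i j)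
    ≡⟨ cong₂ _⊕_ (ℤΣ.bsum-*ˡ (suc q) c h) (bsum-absorb q h) ⟩
  c ⊗ ∑ (suc q) h ⊕ + suc q ⊗ ∑ q (λ i j → h (suc i) j)
    ≡⟨ cong₂ (λ x y → c ⊗ x ⊕ + suc q ⊗ y) (alternating-power-sum (m<n⇒m<1+n (s<s⁻¹ p<q)) c)
         (trans (ℤΣ.bsum-cong q {λ i j → h (suc i) j} {λ i j → -1ℤ ** j ⊗ ((c ⊕ 1ℤ) ⊕ + i) ** p}
                  (λ i j _ → cong (λ x → -1ℤ ** j ⊗ x ** p) (sym (ℤ.+-assoc c 1ℤ (+ i)))))
                (alternating-power-sum (s<s⁻¹ p<q) (c ⊕ 1ℤ))) ⟩
  c ⊗ 0ℤ ⊕ + suc q ⊗ 0ℤ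
    ≡⟨ cong₂ _⊕_ (ℤ.*-zeroʳ c) (ℤ.*-zeroʳ (+ suc q)) ⟩
  0ℤ ∎
  where
  h : ℕ → ℕ → ℤ
  h i j = -1ℤ ** j ⊗ (c ⊕ + i) ** p
  split : ∀ s c i x → s ⊗ ((c ⊕ i) ⊗ x) ≡ c ⊗ (s ⊗ x) ⊕ i ⊗ (s ⊗ x)
  split = ℤ-Solver.solve-∀

-- The number of parking functions of length i; at i = 0 the exponent -1 is truncated to 0.
pf : ℕ → ℕ
pf i = suc i ^ (i ∸ 1)

neg-** : ∀ x n → neg x ** n ≡ -1ℤ ** n ⊗ x ** n
neg-** x zero    = refl
neg-** x (suc n) = trans (cong (neg x ⊗_) (neg-** x n)) (lem x (-1ℤ ** n) (x ** n))
  where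
  lem : ∀ x a b → neg x ⊗ (a ⊗ b) ≡ -1ℤ ⊗ a ⊗ (x ⊗ b)
  lem = ℤ-Solver.solve-∀

-- Abel's identity at y = 0. As i + j = q + 1, the two powers of i + 1 combine to (i + 1)^q, which
-- leaves a difference of order q + 1 of a polynomial of degree q.
abel-constant-term : ∀ q → ∑ (suc q) (λ i j → + pf i ⊗ neg (+ suc i) ** j) ≡ 0ℤ
abel-constant-term q = trans (ℤΣ.bsum-cong (suc q) term) (alternating-power-sum (n<1+n q) 1ℤ)
  where
  term : ∀ i j → i + j ≡ suc q → + pf i ⊗ neg (+ suc i) ** j ≡ -1ℤ ** j ⊗ (1ℤ ⊕ + i) ** q
  -- The exponents do not combine for i = 0, but there the base i + 1 is 1.
  term zero    j _ = trans (ℤ.*-identityˡ _)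
    (sym (trans (cong (-1ℤ ** j ⊗_) (ℤ.^-zeroˡ q)) (ℤ.*-identityʳ _)))
  term (suc i) j p = begin
    + pf (suc i) ⊗ neg (+ suc (suc i)) ** j
      ≡⟨ cong₂ _⊗_ (pos-^ (suc (suc i)) i) (neg-** (+ suc (suc i)) j) ⟩
    b ** i ⊗ (-1ℤ ** j ⊗ b ** j)
      ≡⟨ lem (b ** i) (-1ℤ ** j) (b ** j) ⟩
    -1ℤ ** j ⊗ (b ** i ⊗ b ** j)
      ≡⟨ cong (-1ℤ ** j ⊗_) (ℤ.^-distribˡ-+-* b i j) ⟨
    -1ℤ ** j ⊗ b ** (i + j)
      ≡⟨ cong (λ k → -1ℤ ** j ⊗ b ** k) (suc-injective p) ⟩
    -1ℤ ** j ⊗ b ** q ∎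
    where
    b = + suc (suc i)
    lem : ∀ x y z → x ⊗ (y ⊗ z) ≡ y ⊗ (x ⊗ z)
    lem = ℤ-Solver.solve-∀

-- Expanded in powers of y, the coefficient of y^l contains the sum at y = 0 for q = n - l, which
-- vanishes unless q = 0.
abel : ∀ n y → ∑ n (λ i j → + pf i ⊗ (y ⊝ + suc i) ** j) ≡ y ** n
abel n y = begin
  ∑ n (λ i j → + pf i ⊗ (y ⊝ + suc i) ** j)
    ≡⟨ ℤΣ.bsum-cong n (λ i j _ → expand i j) ⟩
  ∑ n (λ i j → ∑ j (λ k l → + pf i ⊗ neg (+ suc i) ** k ⊗ y ** l))
    ≡⟨ ℤΣ.bsum-assoc n _ ⟨
  ∑ n (λ q l → ∑ q (λ i k → + pf i ⊗ neg (+ suc i) ** k ⊗ y ** l))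
    ≡⟨ ℤΣ.bsum-cong n (λ q l _ → ℤΣ.bsum-*ʳ q _ (y ** l)) ⟩
  ∑ n (λ q l → ∑ q (λ i k → + pf i ⊗ neg (+ suc i) ** k) ⊗ y ** l)
    ≡⟨ ℤΣ.bsum-first n _ (λ q l _ →
         trans (cong (_⊗ y ** l) (abel-constant-term q)) (ℤ.*-zeroˡ (y ** l))) ⟩
  1ℤ ⊗ y ** n
    ≡⟨ ℤ.*-identityˡ (y ** n) ⟩
  y ** n ∎
  where
  expand : ∀ i j → + pf i ⊗ (y ⊝ + suc i) ** j ≡ ∑ j (λ k l → + pf i ⊗ neg (+ suc i) ** k ⊗ y ** l)
  expand i j = begin
    + pf i ⊗ (y ⊝ + suc i) ** j
      ≡⟨ cong (λ z → + pf i ⊗ z ** j) (ℤ.+-comm y (neg (+ suc i))) ⟩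
    + pf i ⊗ (neg (+ suc i) ⊕ y) ** j
      ≡⟨ cong (+ pf i ⊗_) (binomial-theorem j (neg (+ suc i)) y) ⟨
    + pf i ⊗ ∑ j (λ k l → neg (+ suc i) ** k ⊗ y ** l)
      ≡⟨ ℤΣ.bsum-*ˡ j (+ pf i) _ ⟨
    ∑ j (λ k l → + pf i ⊗ (neg (+ suc i) ** k ⊗ y ** l))
      ≡⟨ ℤΣ.bsum-cong j (λ k l _ → ℤ.*-assoc (+ pf i) (neg (+ suc i) ** k) (y ** l)) ⟨
    ∑ j (λ k l → + pf i ⊗ neg (+ suc i) ** k ⊗ y ** l) ∎

-- Expansion of the counting functions

ind : ∀ {P : Set} → Dec P → ℕ
ind p? = if does p? then 1 else 0

ind-cong : ∀ {P Q : Set} → P ⇔ Q → (p? : Dec P) (q? : Dec Q) → ind p? ≡ ind q?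
ind-cong P⇔Q p? q? = cong (if_then 1 else 0) (does-⇔ P⇔Q p? q?)

ind-× : ∀ {P Q : Set} (p? : Dec P) (q? : Dec Q) → ind (p? ×-dec q?) ≡ ind p? * ind q?
ind-× p? q? with does p?
... | true  = sym (*-identityˡ (ind q?))
... | false = refl

trunc : ℕ → (ℕ → ℕ) → ℕ → ℕ
trunc a f i = ind (a ≤? i) * f i

trunc-≥ : ∀ {a i} f → a ≤ i → trunc a f i ≡ f i
trunc-≥ {a} {i} f a≤i =
  trans (cong (λ b → (if b then 1 else 0) * f i) (dec-true (a ≤? i) a≤i)) (*-identityˡ (f i))

trunc-< : ∀ {a i} f → i < a → trunc a f i ≡ 0
trunc-< {a} {i} f i<a = cong (λ b → (if b then 1 else 0) * f i) (dec-false (a ≤? i) (<⇒≱ i<a))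

-- Binomial convolution: the product of exponential generating functions.
conv : (ℕ → ℕ) → (ℕ → ℕ) → ℕ → ℕ
conv f g n = bsum n (λ i j → f i * g j)

-- For n < a every term has i ≤ n < a and is already zero. This puts a convolution into the
-- truncated shape that `expansion` requires.
trunc-conv : ∀ a f g n → trunc a (conv (trunc a f) g) n ≡ conv (trunc a f) g n
trunc-conv a f g n with ≤-<-connex a n
... | inj₁ a≤n = trunc-≥ (conv (trunc a f) g) a≤n
... | inj₂ n<a = trans (trunc-< (conv (trunc a f) g) n<a) (sym (bsum-zero n λ i j p →
  cong (_* g j) (trunc-< f (≤-<-trans (m+n≤o⇒m≤o i (≤-reflexive p)) n<a))))

-- Integers are used because the base x - i - 1 can be negative.
expansion : ℕ → (ℕ → ℕ) → ℤ → ℕ → ℤ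
expansion a f x n = ∑ n (λ i j → + trunc a f i ⊗ (x ⊝ + suc i) ** j)

expansion-< : ∀ {a n} f x → n < a → expansion a f x n ≡ 0ℤ
expansion-< {n = n} f x n<a = ℤΣ.bsum-zero n λ i j p →
  trans (cong (λ y → + y ⊗ (x ⊝ + suc i) ** j) (trunc-< f (≤-<-trans (m+n≤o⇒m≤o i (≤-reflexive p)) n<a)))
        (ℤ.*-zeroˡ ((x ⊝ + suc i) ** j))

-- After reassociation the inner sum is the binomial theorem with second summand 1, so each base
-- grows by one.
expansion-shift : ∀ a f x n → ∑ n (λ i _ → expansion a f x i) ≡ expansion a f (1ℤ ⊕ x) n
expansion-shift a f x n = begin
  ∑ n (λ i k → ∑ i (λ s j → F s ⊗ (x ⊝ + suc s) ** j))
    ≡⟨ ℤΣ.bsum-assoc n (λ s j k → F s ⊗ (x ⊝ + suc s) ** j) ⟩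
  ∑ n (λ s r → ∑ r (λ j k → F s ⊗ (x ⊝ + suc s) ** j))
    ≡⟨ ℤΣ.bsum-cong n (λ s r _ → inner s r) ⟩
  expansion a f (1ℤ ⊕ x) n ∎
  where
  F : ℕ → ℤ
  F s = + trunc a f s
  inner : ∀ s r → ∑ r (λ j k → F s ⊗ (x ⊝ + suc s) ** j) ≡ F s ⊗ ((1ℤ ⊕ x) ⊝ + suc s) ** r
  inner s r = begin
    ∑ r (λ j k → F s ⊗ (x ⊝ + suc s) ** j)
      ≡⟨ ℤΣ.bsum-*ˡ r (F s) _ ⟩
    F s ⊗ ∑ r (λ j k → (x ⊝ + suc s) ** j)
      ≡⟨ cong (F s ⊗_) (ℤΣ.bsum-cong r λ j k _ →
           sym (trans (cong ((x ⊝ + suc s) ** j ⊗_) (ℤ.^-zeroˡ k)) (ℤ.*-identityʳ _))) ⟩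
    F s ⊗ ∑ r (λ j k → (x ⊝ + suc s) ** j ⊗ 1ℤ ** k)
      ≡⟨ cong (F s ⊗_) (binomial-theorem r (x ⊝ + suc s) 1ℤ) ⟩
    F s ⊗ ((x ⊝ + suc s) ⊕ 1ℤ) ** r
      ≡⟨ cong (λ y → F s ⊗ y ** r) (lem x (+ suc s)) ⟩
    F s ⊗ ((1ℤ ⊕ x) ⊝ + suc s) ** r ∎
    where
    lem : ∀ x s → (x ⊝ s) ⊕ 1ℤ ≡ (1ℤ ⊕ x) ⊝ s
    lem = ℤ-Solver.solve-∀

-- The term i = a carries the factor (a + 1 - (a + 1))^(n - a) = 0.
expansion-suc : ∀ {a n} f → a < n → expansion a f (+ suc a) n ≡ expansion (suc a) f (+ suc a) n
expansion-suc {a} {n} f a<n = ℤΣ.bsum-cong n term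
  where
  term : ∀ i j → i + j ≡ n →
    + trunc a f i ⊗ (+ suc a ⊝ + suc i) ** j ≡ + trunc (suc a) f i ⊗ (+ suc a ⊝ + suc i) ** j
  term i j p with <-cmp i a
  ... | tri< i<a _ _ = cong (λ y → + y ⊗ (+ suc a ⊝ + suc i) ** j)
        (trans (trunc-< f i<a) (sym (trunc-< f (m<n⇒m<1+n i<a))))
  ... | tri> _ _ a<i = cong (λ y → + y ⊗ (+ suc a ⊝ + suc i) ** j)
        (trans (trunc-≥ f (<⇒≤ a<i)) (sym (trunc-≥ f a<i)))
  ... | tri≈ _ refl _ with j
  ...   | zero  = contradiction (trans (sym (+-identityʳ a)) p) (<⇒≢ a<n)
  ...   | suc k = trans (vanish (trunc a f a)) (sym (vanish (trunc (suc a) f a)))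
    where
    vanish : ∀ y → + y ⊗ (+ suc a ⊝ + suc a) ** suc k ≡ 0ℤ
    vanish y = trans
      (cong (λ z → + y ⊗ (z ⊗ z ** k)) (ℤ.+-inverseʳ (+ suc a))) (ℤ.*-zeroʳ (+ y))

-- Abel's identity at y = x - s replaces the power attached to s by a sum over i; collecting the
-- terms with s + i = c yields the convolution with `pf`, and the base drops by one.
expansion-conv : ∀ a f x n → expansion a f (1ℤ ⊕ x) n ≡ expansion a (conv (trunc a f) pf) x n
expansion-conv a f x n = begin
  ∑ n (λ s r → F s ⊗ ((1ℤ ⊕ x) ⊝ + suc s) ** r)
    ≡⟨ ℤΣ.bsum-cong n (λ s r _ → inner s r) ⟩
  ∑ n (λ s r → ∑ r (λ i j → F s ⊗ + pf i ⊗ (x ⊝ + suc (s + i)) ** j))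
    ≡⟨ ℤΣ.bsum-assoc n (λ s i j → F s ⊗ + pf i ⊗ (x ⊝ + suc (s + i)) ** j) ⟨
  ∑ n (λ c j → ∑ c (λ s i → F s ⊗ + pf i ⊗ (x ⊝ + suc (s + i)) ** j))
    ≡⟨ ℤΣ.bsum-cong n (λ c j _ → outer c j) ⟩
  expansion a (conv (trunc a f) pf) x n ∎
  where
  F : ℕ → ℤ
  F s = + trunc a f s
  inner : ∀ s r → F s ⊗ ((1ℤ ⊕ x) ⊝ + suc s) ** r
                  ≡ ∑ r (λ i j → F s ⊗ + pf i ⊗ (x ⊝ + suc (s + i)) ** j)
  inner s r = begin
    F s ⊗ ((1ℤ ⊕ x) ⊝ + suc s) ** r
      ≡⟨ cong (F s ⊗_) (abel r ((1ℤ ⊕ x) ⊝ + suc s)) ⟨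
    F s ⊗ ∑ r (λ i j → + pf i ⊗ (((1ℤ ⊕ x) ⊝ + suc s) ⊝ + suc i) ** j)
      ≡⟨ ℤΣ.bsum-*ˡ r (F s) _ ⟨
    ∑ r (λ i j → F s ⊗ (+ pf i ⊗ (((1ℤ ⊕ x) ⊝ + suc s) ⊝ + suc i) ** j))
      ≡⟨ ℤΣ.bsum-cong r (λ i j _ → trans
           (sym (ℤ.*-assoc (F s) (+ pf i) ((((1ℤ ⊕ x) ⊝ + suc s) ⊝ + suc i) ** j)))
           (cong (λ z → F s ⊗ + pf i ⊗ z ** j) (lem x (+ s) (+ i)))) ⟩
    ∑ r (λ i j → F s ⊗ + pf i ⊗ (x ⊝ + suc (s + i)) ** j) ∎
    where
    lem : ∀ x s i → ((1ℤ ⊕ x) ⊝ (1ℤ ⊕ s)) ⊝ (1ℤ ⊕ i) ≡ x ⊝ (1ℤ ⊕ (s ⊕ i))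
    lem = ℤ-Solver.solve-∀
  outer : ∀ c j → ∑ c (λ s i → F s ⊗ + pf i ⊗ (x ⊝ + suc (s + i)) ** j)
                  ≡ + trunc a (conv (trunc a f) pf) c ⊗ (x ⊝ + suc c) ** j
  outer c j = begin
    ∑ c (λ s i → F s ⊗ + pf i ⊗ (x ⊝ + suc (s + i)) ** j)
      ≡⟨ ℤΣ.bsum-cong c (λ s i p → cong₂ (λ y z → y ⊗ (x ⊝ + suc z) ** j)
           (sym (ℤ.pos-* (trunc a f s) (pf i))) p) ⟩
    ∑ c (λ s i → + (trunc a f s * pf i) ⊗ (x ⊝ + suc c) ** j)
      ≡⟨ ℤΣ.bsum-*ʳ c _ ((x ⊝ + suc c) ** j) ⟩
    ∑ c (λ s i → + (trunc a f s * pf i)) ⊗ (x ⊝ + suc c) ** j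
      ≡⟨ cong (_⊗ (x ⊝ + suc c) ** j) (sym (pos-bsum c _)) ⟩
    + conv (trunc a f) pf c ⊗ (x ⊝ + suc c) ** j
      ≡⟨ cong (λ y → + y ⊗ (x ⊝ + suc c) ** j) (trunc-conv a f pf c) ⟨
    + trunc a (conv (trunc a f) pf) c ⊗ (x ⊝ + suc c) ** j ∎

-- The invariant of the induction over spots: `a` is the number of free spots so far, and it serves
-- both as the truncation point and as the base.
record Counts (a : ℕ) (f H : ℕ → ℕ) : Set where
  field count : ∀ n → + H n ≡ expansion a f (+ a) n
open Counts

-- The binomial sum chooses the positions of the entries that differ from the new spot. Here `a`
-- counts the free spots including the new one, and the truncation imposes the condition at that
-- spot.
addSpot : ℕ → (ℕ → ℕ) → ℕ → ℕ
addSpot a H = trunc a (λ n → bsum n (λ i _ → H i))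

private
  shifted : ∀ {a f H} → Counts a f H → ∀ n → + bsum n (λ i _ → H i) ≡ expansion a f (+ suc a) n
  shifted {a} {f} {H} c n = begin
    + bsum n (λ i _ → H i)              ≡⟨ pos-bsum n _ ⟩
    ∑ n (λ i _ → + H i)                 ≡⟨ ℤΣ.bsum-cong n (λ i _ _ → count c i) ⟩
    ∑ n (λ i _ → expansion a f (+ a) i) ≡⟨ expansion-shift a f (+ a) n ⟩
    expansion a f (+ suc a) n ∎

counts-cong : ∀ {a f H H′} → (∀ n → H n ≡ H′ n) → Counts a f H → Counts a f H′
count (counts-cong eq c) n = trans (cong +_ (sym (eq n))) (count c n)

-- Without spots only the empty sequence exists, hence 0^n with 0^0 = 1; this is Abel's identity at
-- y = 0.
counts-empty : Counts 0 pf (0 ^_)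
count counts-empty n = trans (pos-^ 0 n) (trans (sym (abel n 0ℤ)) (ℤΣ.bsum-cong n λ i j _ →
  cong (λ y → + y ⊗ (0ℤ ⊝ + suc i) ** j) (sym (trunc-≥ {0} {i} pf z≤n))))

-- The raised base a + 1 is already the new number of free spots. Only the truncation moves, and the
-- term it drops has base zero.
counts-free : ∀ {a f H} → Counts a f H → Counts (suc a) f (addSpot (suc a) H)
count (counts-free {a} {f} {H} c) n with ≤-<-connex (suc a) n
... | inj₁ a<n = trans (cong +_ (trunc-≥ (λ n → bsum n (λ i _ → H i)) a<n))
                   (trans (shifted c n) (expansion-suc f a<n))
... | inj₂ n≤a = trans (cong +_ (trunc-< (λ n → bsum n (λ i _ → H i)) n≤a))
                   (sym (expansion-< f (+ suc a) n≤a))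

-- The number of free spots stays at a while the base has become a + 1; Abel's identity lowers it
-- again at the price of a convolution.
counts-taken : ∀ {a f H} → Counts a f H → Counts a (conv (trunc a f) pf) (addSpot a H)
count (counts-taken {a} {f} {H} c) n with ≤-<-connex a n
... | inj₁ a≤n = trans (cong +_ (trunc-≥ (λ n → bsum n (λ i _ → H i)) a≤n))
                   (trans (shifted c n) (expansion-conv a f (+ a) n))
... | inj₂ n<a = trans (cong +_ (trunc-< (λ n → bsum n (λ i _ → H i)) n<a))
                   (sym (expansion-< (conv (trunc a f) pf) (+ a) n<a))

-- At n = a each term with j > 0 has i < a and is truncated, so only i = a, j = 0 survives.
counts-diagonal : ∀ {a f H} → Counts a f H → H a ≡ f a
counts-diagonal {a} {f} {H} c = ℤ.+-injective (begin
  + H a                      ≡⟨ count c a ⟩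
  expansion a f (+ a) a      ≡⟨ ℤΣ.bsum-last a _ (λ i j p → trans
                                  (cong (λ y → + y ⊗ (+ a ⊝ + suc i) ** suc j)
                                    (trunc-< f (subst (i <_) p (m<m+n i (s≤s z≤n)))))
                                  (ℤ.*-zeroˡ ((+ a ⊝ + suc i) ** suc j))) ⟩
  + trunc a f a ⊗ 1ℤ         ≡⟨ ℤ.*-identityʳ _ ⟩
  + trunc a f a              ≡⟨ cong +_ (trunc-≥ f ≤-refl) ⟩
  + f a ∎)

-- Parking completions as sequences with counting conditions

private variable A B : Set

length-filter≡sum : ∀ {P : A → Set} (P? : Decidable P) xs →
  length (filter P? xs) ≡ sum (map (ind ∘ P?) xs)
length-filter≡sum P? []       = refl
length-filter≡sum P? (x ∷ xs) with does (P? x)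
... | true  = cong suc (length-filter≡sum P? xs)
... | false = length-filter≡sum P? xs

sum-map-filter : ∀ {P : A → Set} (P? : Decidable P) (f : A → ℕ) xs →
  sum (map f (filter P? xs)) ≡ sum (map (λ x → f x * ind (P? x)) xs)
sum-map-filter P? f []       = refl
sum-map-filter P? f (x ∷ xs) with does (P? x)
... | true  = cong₂ _+_ (sym (*-identityʳ (f x))) (sum-map-filter P? f xs)
... | false = trans (sum-map-filter P? f xs)
  (cong (_+ sum (map (λ x → f x * ind (P? x)) xs)) (sym (*-zeroʳ (f x))))

sum-map-cong : ∀ {f g : A → ℕ} {xs} → All (λ x → f x ≡ g x) xs → sum (map f xs) ≡ sum (map g xs)
sum-map-cong eq = cong sum (map-cong-local eq)

sum-map-concatMap : ∀ (f : B → ℕ) (g : A → List B) xs →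
  sum (map f (concatMap g xs)) ≡ sum (map (λ x → sum (map f (g x))) xs)
sum-map-concatMap f g []       = refl
sum-map-concatMap f g (x ∷ xs) = begin
  sum (map f (g x ++ concatMap g xs))              ≡⟨ cong sum (map-++ f (g x) _) ⟩
  sum (map f (g x) ++ map f (concatMap g xs))      ≡⟨ sum-++ (map f (g x)) _ ⟩
  sum (map f (g x)) + sum (map f (concatMap g xs)) ≡⟨ cong₂ _+_ refl (sum-map-concatMap f g xs) ⟩
  sum (map (λ x → sum (map f (g x))) (x ∷ xs))     ∎

sum-map-cons : ∀ (f : List ℕ → ℕ) (g : ℕ → List (List ℕ)) xs →
  sum (map f (concatMap (λ x → map (x ∷_) (g x)) xs)) ≡ sum (map (λ x → sum (map (f ∘ (x ∷_)) (g x))) xs)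
sum-map-cons f g xs = trans (sum-map-concatMap f _ xs)
  (cong sum (map-cong (λ x → cong sum (sym (map-∘ (g x)))) xs))

sum-map-*ˡ : ∀ c (f : A → ℕ) xs → sum (map (λ x → c * f x) xs) ≡ c * sum (map f xs)
sum-map-*ˡ c f []       = sym (*-zeroʳ c)
sum-map-*ˡ c f (x ∷ xs) = trans (cong₂ _+_ refl (sum-map-*ˡ c f xs)) (sym (*-distribˡ-+ c (f x) _))

sum-map-bsum : ∀ n (h : A → ℕ → ℕ → ℕ) xs →
  sum (map (λ x → bsum n (h x)) xs) ≡ bsum n (λ i j → sum (map (λ x → h x i j) xs))
sum-map-bsum n h []       = sym (bsum-zero n λ _ _ _ → refl)
sum-map-bsum n h (x ∷ xs) = trans (cong₂ _+_ refl (sum-map-bsum n h xs)) (sym (bsum-+ n (h x) _))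

range-suc : ∀ k → range (suc k) ≡ range k ∷ʳ suc k
range-suc k = trans (cong (map suc) (sym (upTo-∷ʳ k))) (map-++ suc (upTo k) (k ∷ []))

range-bounded : ∀ k → All (_≤ k) (range k)
range-bounded k = All.map⁺ (All.all-upTo k)

range-positive : ∀ k → All (1 ≤_) (range k)
range-positive k = All.map⁺ (All.universal (λ _ → s≤s z≤n) (upTo k))

All-seqs : ∀ {P : ℕ → Set} k n → All P (range k) → All (λ c → length c ≡ n × All P c) (seqs k n)
All-seqs k zero    ps = (refl , []) ∷ []
All-seqs k (suc n) ps = All.concat⁺ (All.map⁺ (All.map
  (λ p → All.map⁺ (All.map (λ (len , qs) → cong suc len , p ∷ qs) (All-seqs k n ps))) ps))

-- The entries equal to k + 1 occupy an arbitrary set of positions.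
seqs-suc : ∀ (w : List ℕ → ℕ) k n →
  sum (map (w ∘ filter (_≤? k)) (seqs (suc k) n)) ≡ bsum n (λ i _ → sum (map w (seqs k i)))
seqs-suc w k zero    = refl
seqs-suc w k (suc n) = begin
  sum (map w′ (seqs (suc k) (suc n)))
    ≡⟨ sum-map-cons w′ (λ _ → seqs (suc k) n) (range (suc k)) ⟩
  sum (map (λ x → T (w′ ∘ (x ∷_))) (range (suc k)))
    ≡⟨ cong (λ l → sum (map (λ x → T (w′ ∘ (x ∷_))) l)) (range-suc k) ⟩
  sum (map (λ x → T (w′ ∘ (x ∷_))) (range k ∷ʳ suc k))
    ≡⟨ cong sum (map-++ (λ x → T (w′ ∘ (x ∷_))) (range k) (suc k ∷ [])) ⟩
  sum (map (λ x → T (w′ ∘ (x ∷_))) (range k) ∷ʳ T (w′ ∘ (suc k ∷_)))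
    ≡⟨ sum-++ (map (λ x → T (w′ ∘ (x ∷_))) (range k)) _ ⟩
  sum (map (λ x → T (w′ ∘ (x ∷_))) (range k)) + (T (w′ ∘ (suc k ∷_)) + 0)
    -- A first entry ≤ k survives the filter and raises i; a first entry k + 1 is deleted and raises
    -- the other index. These are the two summands of Pascal's rule.
    ≡⟨ cong₂ _+_ low (trans (+-identityʳ _) high) ⟩
  bsum (suc n) (λ i _ → sum (map w (seqs k i))) ∎
  where
  w′ : List ℕ → ℕ
  w′ = w ∘ filter (_≤? k)
  T : (List ℕ → ℕ) → ℕ
  T f = sum (map f (seqs (suc k) n))
  low : sum (map (λ x → T (w′ ∘ (x ∷_))) (range k)) ≡ bsum n (λ i _ → sum (map w (seqs k (suc i))))
  low = begin
    sum (map (λ x → T (w′ ∘ (x ∷_))) (range k))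
      ≡⟨ sum-map-cong (All.map (λ {x} x≤k → cong sum (map-cong
           (λ c → cong w (filter-accept (_≤? k) {x} {c} x≤k)) (seqs (suc k) n))) (range-bounded k)) ⟩
    sum (map (λ x → T (w ∘ (x ∷_) ∘ filter (_≤? k))) (range k))
      ≡⟨ cong sum (map-cong (λ x → seqs-suc (w ∘ (x ∷_)) k n) (range k)) ⟩
    sum (map (λ x → bsum n (λ i _ → sum (map (w ∘ (x ∷_)) (seqs k i)))) (range k))
      ≡⟨ sum-map-bsum n (λ x i _ → sum (map (w ∘ (x ∷_)) (seqs k i))) (range k) ⟩
    bsum n (λ i _ → sum (map (λ x → sum (map (w ∘ (x ∷_)) (seqs k i))) (range k)))
      ≡⟨ bsum-cong n (λ i _ _ → sym (sum-map-cons w (λ _ → seqs k i) (range k))) ⟩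
    bsum n (λ i _ → sum (map w (seqs k (suc i)))) ∎
  high : T (w′ ∘ (suc k ∷_)) ≡ bsum n (λ i _ → sum (map w (seqs k i)))
  high = trans
    (cong sum (map-cong (λ c → cong w (filter-reject (_≤? k) {suc k} {c} (<⇒≱ (n<1+n k)))) (seqs (suc k) n)))
    (seqs-suc w k n)

module Acceptance (a : ℕ → ℕ) where

  -- For c with entries in [k]: at least a j entries are ≤ j, for every j ≤ k.
  Accepted : ℕ → List ℕ → Set
  Accepted zero    c = ⊤
  Accepted (suc k) c = a (suc k) ≤ length c × Accepted k (filter (_≤? k) c)

  accepted? : ∀ k c → Dec (Accepted k c)
  accepted? zero    c = yes tt
  accepted? (suc k) c = (a (suc k) ≤? length c) ×-dec accepted? k (filter (_≤? k) c)

  -- The counting function H(n) for the spots in [k].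
  #accepted : ℕ → ℕ → ℕ
  #accepted k n = sum (map (ind ∘ accepted? k) (seqs k n))

  #accepted-zero : ∀ n → #accepted 0 n ≡ 0 ^ n
  #accepted-zero zero    = refl
  #accepted-zero (suc n) = refl

  -- The condition at k + 1 involves only the length and factors out; the remaining ones see only
  -- the entries ≤ k, so the positions of k + 1 are free.
  #accepted-suc : ∀ k n → #accepted (suc k) n ≡ addSpot (a (suc k)) (#accepted k) n
  #accepted-suc k n = begin
    sum (map (ind ∘ accepted? (suc k)) (seqs (suc k) n))
      ≡⟨ sum-map-cong (All.map
           (λ {c} (len , _) → trans (ind-× (a (suc k) ≤? length c) (accepted? k (filter (_≤? k) c)))
             (cong (λ l → ind (a (suc k) ≤? l) * ind (accepted? k (filter (_≤? k) c))) len))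
           (All-seqs (suc k) n (range-positive (suc k)))) ⟩
    sum (map (λ c → ind (a (suc k) ≤? n) * ind (accepted? k (filter (_≤? k) c))) (seqs (suc k) n))
      ≡⟨ sum-map-*ˡ (ind (a (suc k) ≤? n)) _ (seqs (suc k) n) ⟩
    ind (a (suc k) ≤? n) * sum (map (ind ∘ accepted? k ∘ filter (_≤? k)) (seqs (suc k) n))
      ≡⟨ cong (ind (a (suc k) ≤? n) *_) (seqs-suc (ind ∘ accepted? k) k n) ⟩
    addSpot (a (suc k)) (#accepted k) n ∎

-- Pointwise domination in terms of counting functions

cnt : ℕ → List ℕ → ℕ
cnt k xs = length (filter (_≤? k) xs)

cnt-all : ∀ {k xs} → All (_≤ k) xs → cnt k xs ≡ length xs
cnt-all {k} ps = cong length (filter-all (_≤? k) ps)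

cnt-none : ∀ {k xs} → All (k <_) xs → cnt k xs ≡ 0
cnt-none {k} ps = cong length (filter-none (_≤? k) (All.map <⇒≱ ps))

cnt-≤ : ∀ {k x} xs → x ≤ k → cnt k (x ∷ xs) ≡ suc (cnt k xs)
cnt-≤ {k} {x} xs x≤k = cong length (filter-accept (_≤? k) x≤k)

cnt-> : ∀ {k x} xs → k < x → cnt k (x ∷ xs) ≡ cnt k xs
cnt-> {k} {x} xs k<x = cong length (filter-reject (_≤? k) (<⇒≱ k<x))

cnt-filter : ∀ {j k} → j ≤ k → ∀ xs → cnt j (filter (_≤? k) xs) ≡ cnt j xs
cnt-filter j≤k [] = refl
cnt-filter {j} {k} j≤k (x ∷ xs) with ≤-<-connex x k
... | inj₂ k<x = trans (cong (cnt j) (filter-reject (_≤? k) (<⇒≱ k<x)))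
                   (trans (cnt-filter j≤k xs) (sym (cnt-> xs (≤-<-trans j≤k k<x))))
... | inj₁ x≤k = trans (cong (cnt j) (filter-accept (_≤? k) x≤k)) keep
  where
  keep : cnt j (x ∷ filter (_≤? k) xs) ≡ cnt j (x ∷ xs)
  keep with ≤-<-connex x j
  ... | inj₁ x≤j = trans (cnt-≤ _ x≤j) (trans (cong suc (cnt-filter j≤k xs)) (sym (cnt-≤ xs x≤j)))
  ... | inj₂ j<x = trans (cnt-> _ j<x) (trans (cnt-filter j≤k xs) (sym (cnt-> xs j<x)))

-- A count is a sum of indicators, hence invariant under permutation; this removes `sort` from the
-- parking condition.
cnt-↭ : ∀ k {xs ys} → xs ↭ ys → cnt k xs ≡ cnt k ys
cnt-↭ k {xs} {ys} p = trans (length-filter≡sum (_≤? k) xs)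
  (trans (sum-↭ (Perm.map⁺ (λ x → ind (x ≤? k)) p)) (sym (length-filter≡sum (_≤? k) ys)))

Pointwise⇒cnt : ∀ {xs us} → Pointwise _≤_ xs us → ∀ k → cnt k us ≤ cnt k xs
Pointwise⇒cnt [] k = z≤n
Pointwise⇒cnt {x ∷ xs} {u ∷ us} (x≤u ∷ ps) k with ≤-<-connex u k
... | inj₁ u≤k = subst₂ _≤_ (sym (cnt-≤ us u≤k)) (sym (cnt-≤ xs (≤-trans x≤u u≤k)))
                   (s≤s (Pointwise⇒cnt ps k))
... | inj₂ k<u with ≤-<-connex x k
...   | inj₁ x≤k = subst₂ _≤_ (sym (cnt-> us k<u)) (sym (cnt-≤ xs x≤k)) (m≤n⇒m≤1+n (Pointwise⇒cnt ps k))
...   | inj₂ k<x = subst₂ _≤_ (sym (cnt-> us k<u)) (sym (cnt-> xs k<x)) (Pointwise⇒cnt ps k)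

-- The count at k = u, the head of `us`, forces an entry ≤ u in `xs`, and the head x is its
-- smallest. The heads then cancel: both are counted for k ≥ u, and for k < u nothing in `us` is.
cnt⇒Pointwise : ∀ {n xs us} → AllPairs _≤_ xs → AllPairs _≤_ us → length xs ≡ length us →
  All (_≤ n) us → (∀ k → k ≤ n → cnt k us ≤ cnt k xs) → Pointwise _≤_ xs us
cnt⇒Pointwise {xs = []}     {[]}     _ _ _ _ _ = []
cnt⇒Pointwise {n} {x ∷ xs} {u ∷ us} (x≤xs ∷ sx) (u≤us ∷ su) len (u≤n ∷ us≤n) dom =
  x≤u ∷ cnt⇒Pointwise sx su (suc-injective len) us≤n dom′
  where
  x≤u : x ≤ u
  x≤u with ≤-<-connex x u
  ... | inj₁ x≤u = x≤u
  ... | inj₂ u<x = contradiction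
    (subst₂ _≤_ (cnt-≤ {u} us ≤-refl) (cnt-none (u<x ∷ All.map (<-≤-trans u<x) x≤xs)) (dom u u≤n))
    λ ()
  dom′ : ∀ k → k ≤ n → cnt k us ≤ cnt k xs
  dom′ k k≤n with ≤-<-connex u k
  ... | inj₁ u≤k = s≤s⁻¹ (subst₂ _≤_ (cnt-≤ us u≤k) (cnt-≤ xs (≤-trans x≤u u≤k)) (dom k k≤n))
  ... | inj₂ k<u = subst (_≤ cnt k xs) (sym (cnt-none (All.map (<-≤-trans k<u) u≤us))) z≤n

-- Free spots and the equivalence of parking with acceptance

module _ (t : List ℕ) where

  #free : ℕ → ℕ
  #free k = length (freeSpots k t)

  open Acceptance #free public

  freeSpots-suc : ∀ k → freeSpots (suc k) t ≡ freeSpots k t ++ filter (λ x → ¬? (x ∈? t)) (suc k ∷ [])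
  freeSpots-suc k = trans (cong (filter _) (range-suc k)) (filter-++ _ (range k) (suc k ∷ []))

  freeSpots-∈ : ∀ {k} → suc k ∈ t → freeSpots (suc k) t ≡ freeSpots k t
  freeSpots-∈ {k} k∈t = trans (freeSpots-suc k)
    (trans (cong (freeSpots k t ++_) (filter-reject (λ x → ¬? (x ∈? t)) {suc k} {[]} (λ ¬p → ¬p k∈t))) (++-identityʳ _))

  freeSpots-∉ : ∀ {k} → ¬ (suc k ∈ t) → freeSpots (suc k) t ≡ freeSpots k t ∷ʳ suc k
  freeSpots-∉ {k} k∉t = trans (freeSpots-suc k)
    (cong (freeSpots k t ++_) (filter-accept (λ x → ¬? (x ∈? t)) {suc k} {[]} k∉t))

  freeSpots-bounded : ∀ n → All (_≤ n) (freeSpots n t)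
  freeSpots-bounded n = All.filter⁺ _ (range-bounded n)

  freeSpots-sorted : ∀ n → AllPairs _≤_ (freeSpots n t)
  freeSpots-sorted n = AllPairs.filter⁺ _ (AllPairs.map⁺ (AllPairs.applyUpTo⁺₁ id n (λ i<j _ → s≤s (<⇒≤ i<j))))

  cnt-freeSpots : ∀ {k} n → k ≤ n → cnt k (freeSpots n t) ≡ #free k
  cnt-freeSpots {k} n k≤n with m≤n⇒m<n∨m≡n k≤n
  ... | inj₂ refl = cnt-all (freeSpots-bounded k)
  cnt-freeSpots {k} (suc n) _ | inj₁ (s≤s k≤n) with suc n ∈? t
  ... | yes p = trans (cong (cnt k) (freeSpots-∈ p)) (cnt-freeSpots n k≤n)
  ... | no ¬p = begin
    cnt k (freeSpots (suc n) t)
      ≡⟨ cong (cnt k) (freeSpots-∉ ¬p) ⟩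
    length (filter (_≤? k) (freeSpots n t ∷ʳ suc n))
      ≡⟨ cong length (filter-++ (_≤? k) (freeSpots n t) (suc n ∷ [])) ⟩
    length (filter (_≤? k) (freeSpots n t) ++ filter (_≤? k) (suc n ∷ []))
      ≡⟨ cong (λ l → length (filter (_≤? k) (freeSpots n t) ++ l))
           (filter-reject (_≤? k) {suc n} {[]} (<⇒≱ (s≤s k≤n))) ⟩
    length (filter (_≤? k) (freeSpots n t) ++ [])
      ≡⟨ cong length (++-identityʳ (filter (_≤? k) (freeSpots n t))) ⟩
    cnt k (freeSpots n t)
      ≡⟨ cnt-freeSpots n k≤n ⟩
    #free k ∎

  -- With all entries ≤ k the length of `c` is its count at k; smaller counts are unchanged by
  -- filtering.
  Accepted⇒cnt : ∀ {k c} → All (_≤ k) c → Accepted k c → ∀ j → j ≤ k → #free j ≤ cnt j c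
  Accepted⇒cnt {zero}      c≤k _        zero j≤k = z≤n
  Accepted⇒cnt {suc k} {c} c≤k (p , ps) j    j≤k with m≤n⇒m<n∨m≡n j≤k
  ... | inj₂ refl = subst (#free j ≤_) (sym (cnt-all c≤k)) p
  ... | inj₁ (s≤s j≤k′) = subst (#free j ≤_) (cnt-filter j≤k′ c)
                            (Accepted⇒cnt (All.all-filter (_≤? k) c) ps j j≤k′)

  cnt⇒Accepted : ∀ {k} c → (∀ j → j ≤ k → #free j ≤ cnt j c) → Accepted k c
  cnt⇒Accepted {zero}  c dom = tt
  cnt⇒Accepted {suc k} c dom =
    ≤-trans (dom (suc k) ≤-refl) (length-filter (_≤? suc k) c) ,
    cnt⇒Accepted (filter (_≤? k) c) (λ j j≤k → subst (#free j ≤_) (sym (cnt-filter j≤k c)) (dom j (m≤n⇒m≤1+n j≤k)))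

  -- The sorted sequence and the free spots are increasing lists of equal length, so domination
  -- entry by entry amounts to comparing counts, which do not see the sorting.
  IsPC⇔Accepted : ∀ {n c} → length c ≡ #free n → All (1 ≤_) c → All (_≤ n) c → IsPC n t c ⇔ Accepted n c
  IsPC⇔Accepted {n} {c} len 1≤c c≤n = mk⇔
    (λ (_ , _ , pw) → cnt⇒Accepted c λ j j≤n →
      subst₂ _≤_ (cnt-freeSpots n j≤n) (cnt-↭ j (sort-↭ c)) (Pointwise⇒cnt pw j))
    (λ acc → sort-↗ c , Perm.All-resp-↭ (↭-sym (sort-↭ c)) 1≤c ,
      cnt⇒Pointwise (Linked⇒AllPairs ≤-trans (sort-↗ c)) (freeSpots-sorted n)
        (trans (Perm.↭-length (sort-↭ c)) len) (freeSpots-bounded n)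
        (λ j j≤n → subst₂ _≤_ (sym (cnt-freeSpots n j≤n)) (cnt-↭ j (↭-sym (sort-↭ c)))
          (Accepted⇒cnt c≤n acc j j≤n)))

  #PC : ∀ n → length (filter (isPC? n t) (seqs n (#free n))) ≡ #accepted n (#free n)
  #PC n = trans (length-filter≡sum (isPC? n t) (seqs n (#free n)))
    (sum-map-cong (All.map
      (λ {c} (len , ps) → ind-cong (IsPC⇔Accepted len (All.map proj₁ ps) (All.map proj₂ ps))
                            (isPC? n t c) (accepted? n c))
      (All-seqs n (#free n) (All.zip (range-positive n , range-bounded n)))))

-- Sums over compositions

sum-applyUpTo-cong : ∀ {f g : ℕ → ℕ} n → (∀ i → i < n → f i ≡ g i) → sum (applyUpTo f n) ≡ sum (applyUpTo g n)
sum-applyUpTo-cong zero    eq = refl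
sum-applyUpTo-cong (suc n) eq =
  cong₂ _+_ (eq 0 (s≤s z≤n)) (sum-applyUpTo-cong n λ i i<n → eq (suc i) (s≤s i<n))

sum-applyUpTo-+ : ∀ (f g : ℕ → ℕ) n →
  sum (applyUpTo (λ i → f i + g i) n) ≡ sum (applyUpTo f n) + sum (applyUpTo g n)
sum-applyUpTo-+ f g zero    = refl
sum-applyUpTo-+ f g (suc n) = trans (cong₂ _+_ refl (sum-applyUpTo-+ (f ∘ suc) (g ∘ suc) n))
  (+-interchange (f 0) (g 0) (sum (applyUpTo (f ∘ suc) n)) (sum (applyUpTo (g ∘ suc) n)))
  where
  +-interchange : ∀ a b c d → a + b + (c + d) ≡ a + c + (b + d)
  +-interchange = solve-∀

sum-applyUpTo-last : ∀ f n → sum (applyUpTo f (suc n)) ≡ sum (applyUpTo f n) + f n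
sum-applyUpTo-last f n = begin
  sum (applyUpTo f (suc n))     ≡⟨ cong sum (applyUpTo-∷ʳ f n) ⟨
  sum (applyUpTo f n ∷ʳ f n)    ≡⟨ sum-++ (applyUpTo f n) _ ⟩
  sum (applyUpTo f n) + (f n + 0) ≡⟨ cong₂ _+_ refl (+-identityʳ (f n)) ⟩
  sum (applyUpTo f n) + f n     ∎

-- Links the Pascal form of the binomial sum to explicit coefficients, as needed for multinomials
-- defined by factorials.
bsum≡∑C : ∀ n h → bsum n h ≡ sum (applyUpTo (λ i → (n C i) * h i (n ∸ i)) (suc n))
bsum≡∑C zero    h = sym (trans (+-identityʳ (h 0 0 + 0)) (+-identityʳ (h 0 0)))
bsum≡∑C (suc n) h = begin
  bsum n (λ i j → h (suc i) j) + bsum n (λ i j → h i (suc j))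
    ≡⟨ cong₂ _+_ (bsum≡∑C n _) (trans (bsum≡∑C n _) extend) ⟩
  S f (suc n) + S g (suc (suc n))
    ≡⟨ rearrange (S f (suc n)) (g 0) (S (g ∘ suc) (suc n)) ⟩
  g 0 + (S f (suc n) + S (g ∘ suc) (suc n))
    ≡⟨ cong₂ _+_ (refl {x = g 0}) (sum-applyUpTo-+ f (g ∘ suc) (suc n)) ⟨
  g 0 + S (λ i → f i + g (suc i)) (suc n)
    ≡⟨ cong₂ _+_ (refl {x = g 0}) (sum-applyUpTo-cong (suc n) λ i _ → trans
         (sym (*-distribʳ-+ (h (suc i) (n ∸ i)) (n C i) (n C suc i)))
         (cong (_* h (suc i) (n ∸ i)) (nCk+nC[k+1]≡[n+1]C[k+1] n i))) ⟩
  S (λ i → (suc n C i) * h i (suc n ∸ i)) (suc (suc n)) ∎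
  where
  S : (ℕ → ℕ) → ℕ → ℕ
  S f m = sum (applyUpTo f m)
  f g : ℕ → ℕ
  f i = (n C i) * h (suc i) (n ∸ i)
  g i = (n C i) * h i (suc n ∸ i)
  rearrange : ∀ a b c → a + (b + c) ≡ b + (a + c)
  rearrange = solve-∀
  -- Appends the term i = n + 1, which is zero because (n choose n + 1) = 0, so that splitting off i
  -- = 0 leaves two sums of equal length.
  extend : S (λ i → (n C i) * h i (suc (n ∸ i))) (suc n) ≡ S g (suc (suc n))
  extend = begin
    S (λ i → (n C i) * h i (suc (n ∸ i))) (suc n)
      ≡⟨ sum-applyUpTo-cong (suc n) (λ i i≤n →
           cong (λ j → (n C i) * h i j) (sym (+-∸-assoc 1 (s≤s⁻¹ i≤n)))) ⟩
    S g (suc n)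
      ≡⟨ +-identityʳ _ ⟨
    S g (suc n) + 0
      ≡⟨ cong (λ c → S g (suc n) + c * h (suc n) (n ∸ n)) (k>n⇒nCk≡0 (n<1+n n)) ⟨
    S g (suc n) + g (suc n)
      ≡⟨ sum-applyUpTo-last g (suc n) ⟨
    S g (suc (suc n)) ∎

-- Makes the division in `multinomial` exact; each step uses that x! s! divides (x + s)!.
prodFact∣sum! : ∀ ℓ → prodFact ℓ ∣ sum ℓ !
prodFact∣sum! []      = ∣-refl
prodFact∣sum! (x ∷ ℓ) = ∣-trans (*-monoʳ-∣ (x !) (prodFact∣sum! ℓ))
  (subst (λ k → x ! * k ! ∣ (x + sum ℓ) !) (m+n∸m≡n x (sum ℓ)) (k![n∸k]!∣n! (m≤m+n x (sum ℓ))))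

C-factorials : ∀ {n k} → k ≤ n → (n C k) * (k ! * (n ∸ k) !) ≡ n !
C-factorials {n} {k} k≤n = trans (cong (_* (k ! * (n ∸ k) !)) (nCk≡n!/k![n-k]! k≤n))
  (m/n*n≡m {{k !* (n ∸ k) !≢0}} (k![n∸k]!∣n! k≤n))

-- Choose the first block, then distribute the rest. All divisions are exact, so the identity is
-- checked after multiplying by the denominator.
multinomial-∷ : ∀ {n x} ℓ → x ≤ n → sum ℓ ≡ n ∸ x →
  multinomial n (x ∷ ℓ) ≡ (n C x) * multinomial (n ∸ x) ℓ
multinomial-∷ {n} {x} ℓ x≤n eq = trans
  (/-congˡ {{prodFact≢0 (x ∷ ℓ)}} (begin
    n !                                 ≡⟨ C-factorials x≤n ⟨
    (n C x) * (x ! * (n ∸ x) !)         ≡⟨ cong (λ y → (n C x) * (x ! * y)) (m/n*n≡m {{prodFact≢0 ℓ}}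
                                             (subst (λ k → prodFact ℓ ∣ k !) eq (prodFact∣sum! ℓ))) ⟨
    (n C x) * (x ! * (M * prodFact ℓ))  ≡⟨ rearrange (n C x) (x !) M (prodFact ℓ) ⟩
    (n C x) * M * prodFact (x ∷ ℓ)      ∎))
  (m*n/n≡m ((n C x) * M) (prodFact (x ∷ ℓ)) {{prodFact≢0 (x ∷ ℓ)}})
  where
  M : ℕ
  M = multinomial (n ∸ x) ℓ
  rearrange : ∀ c x m p → c * (x * (m * p)) ≡ c * m * (x * p)
  rearrange = solve-∀

comps-sum : ∀ p n → All (λ ℓ → sum ℓ ≡ n) (comps p n)
comps-sum zero    zero    = refl ∷ []
comps-sum zero    (suc n) = []
comps-sum (suc p) n = All.concat⁺ (All.map⁺ (All.map
  (λ {x} x≤n → All.map⁺ (All.map (λ eq → trans (cong₂ _+_ refl eq) (m+[n∸m]≡n (s≤s⁻¹ x≤n)))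
                                 (comps-sum p (n ∸ x))))
  (All.all-upTo (suc n))))

-- The free weight `φ` will be the indicator of the partial-sum conditions, which turns the filter
-- in `Lset` into a factor.
compSum : ℕ → ℕ → (List ℕ → ℕ) → ℕ
compSum p n φ = sum (map (λ ℓ → multinomial n ℓ * pfProd ℓ * φ ℓ) (comps p n))

compSum-cong : ∀ p n {φ ψ} → (∀ ℓ → φ ℓ ≡ ψ ℓ) → compSum p n φ ≡ compSum p n ψ
compSum-cong p n eq = cong sum (map-cong (λ ℓ → cong (multinomial n ℓ * pfProd ℓ *_) (eq ℓ)) (comps p n))

compSum-*ˡ : ∀ p n c φ → compSum p n (λ ℓ → c * φ ℓ) ≡ c * compSum p n φ
compSum-*ˡ p n c φ = trans
  (cong sum (map-cong (λ ℓ → rearrange (multinomial n ℓ * pfProd ℓ) c (φ ℓ)) (comps p n)))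
  (sum-map-*ˡ c _ (comps p n))
  where
  rearrange : ∀ w c x → w * (c * x) ≡ c * (w * x)
  rearrange = solve-∀

compSum-suc : ∀ p n φ → compSum (suc p) n φ ≡ bsum n (λ x y → pf x * compSum p y (φ ∘ (x ∷_)))
compSum-suc p n φ = begin
  compSum (suc p) n φ
    ≡⟨ sum-map-cons (λ ℓ → multinomial n ℓ * pfProd ℓ * φ ℓ) (λ x → comps p (n ∸ x)) (upTo (suc n)) ⟩
  sum (map (λ x → sum (map (λ ℓ → multinomial n (x ∷ ℓ) * (pf x * pfProd ℓ) * φ (x ∷ ℓ)) (comps p (n ∸ x))))
    (upTo (suc n)))
    ≡⟨ cong sum (map-upTo _ (suc n)) ⟩
  sum (applyUpTo (λ x → sum (map (λ ℓ → multinomial n (x ∷ ℓ) * (pf x * pfProd ℓ) * φ (x ∷ ℓ)) (comps p (n ∸ x))))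
    (suc n))
    ≡⟨ sum-applyUpTo-cong (suc n) (λ x x≤n → peel x (s≤s⁻¹ x≤n)) ⟩
  sum (applyUpTo (λ x → (n C x) * (pf x * compSum p (n ∸ x) (φ ∘ (x ∷_)))) (suc n))
    ≡⟨ bsum≡∑C n (λ x y → pf x * compSum p y (φ ∘ (x ∷_))) ⟨
  bsum n (λ x y → pf x * compSum p y (φ ∘ (x ∷_))) ∎
  where
  rearrange : ∀ c m f p x → c * m * (f * p) * x ≡ c * f * (m * p * x)
  rearrange = solve-∀
  peel : ∀ x → x ≤ n →
    sum (map (λ ℓ → multinomial n (x ∷ ℓ) * (pf x * pfProd ℓ) * φ (x ∷ ℓ)) (comps p (n ∸ x)))
      ≡ (n C x) * (pf x * compSum p (n ∸ x) (φ ∘ (x ∷_)))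
  peel x x≤n = begin
    sum (map (λ ℓ → multinomial n (x ∷ ℓ) * (pf x * pfProd ℓ) * φ (x ∷ ℓ)) (comps p (n ∸ x)))
      ≡⟨ sum-map-cong (All.map (λ {ℓ} eq → trans
           (cong (λ m → m * (pf x * pfProd ℓ) * φ (x ∷ ℓ)) (multinomial-∷ ℓ x≤n eq))
           (rearrange (n C x) (multinomial (n ∸ x) ℓ) (pf x) (pfProd ℓ) (φ (x ∷ ℓ))))
           (comps-sum p (n ∸ x))) ⟩
    sum (map (λ ℓ → (n C x) * pf x * (multinomial (n ∸ x) ℓ * pfProd ℓ * φ (x ∷ ℓ))) (comps p (n ∸ x)))
      ≡⟨ sum-map-*ˡ ((n C x) * pf x) _ (comps p (n ∸ x)) ⟩
    (n C x) * pf x * compSum p (n ∸ x) (φ ∘ (x ∷_))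
      ≡⟨ *-assoc (n C x) (pf x) _ ⟩
    (n C x) * (pf x * compSum p (n ∸ x) (φ ∘ (x ∷_))) ∎

-- Partial-sum conditions and iterated truncated convolution

-- Here `o` is the sum of the parts already read, and a threshold is tested against `o` before the
-- next part is read. Missing parts count as zero, as with `take` in `InL`.
Admissible : List ℕ → ℕ → List ℕ → Set
Admissible []       o ℓ       = ⊤
Admissible (θ ∷ θs) o []      = θ ≤ o × Admissible θs o []
Admissible (θ ∷ θs) o (x ∷ ℓ) = θ ≤ o × Admissible θs (o + x) ℓ

admissible? : ∀ θs o ℓ → Dec (Admissible θs o ℓ)
admissible? []       o ℓ       = yes tt
admissible? (θ ∷ θs) o []      = (θ ≤? o) ×-dec admissible? θs o []
admissible? (θ ∷ θs) o (x ∷ ℓ) = (θ ≤? o) ×-dec admissible? θs (o + x) ℓ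

admissibleSum : List ℕ → ℕ → ℕ → ℕ
admissibleSum θs o n = compSum (length θs) n (ind ∘ admissible? θs o)

-- The first condition depends on `o` alone and factors out; the first part x then joins the offset.
admissibleSum-∷ : ∀ θ θs o n → admissibleSum (θ ∷ θs) o n
  ≡ ind (θ ≤? o) * bsum n (λ x y → pf x * admissibleSum θs (o + x) y)
admissibleSum-∷ θ θs o n = begin
  admissibleSum (θ ∷ θs) o n
    ≡⟨ compSum-suc (length θs) n _ ⟩
  bsum n (λ x y → pf x * compSum (length θs) y (λ ℓ → ind (admissible? (θ ∷ θs) o (x ∷ ℓ))))
    ≡⟨ bsum-cong n (λ x y _ → trans
         (cong (pf x *_) (trans
           (compSum-cong (length θs) y (λ ℓ → ind-× (θ ≤? o) (admissible? θs (o + x) ℓ)))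
           (compSum-*ˡ (length θs) y (ind (θ ≤? o)) _)))
         (rearrange (pf x) (ind (θ ≤? o)) (admissibleSum θs (o + x) y))) ⟩
  bsum n (λ x y → ind (θ ≤? o) * (pf x * admissibleSum θs (o + x) y))
    ≡⟨ bsum-*ˡ n (ind (θ ≤? o)) _ ⟩
  ind (θ ≤? o) * bsum n (λ x y → pf x * admissibleSum θs (o + x) y) ∎
  where
  rearrange : ∀ f i s → f * (i * s) ≡ i * (f * s)
  rearrange = solve-∀

addBlock : (ℕ → ℕ) → ℕ → ℕ → ℕ
addBlock f θ = conv (trunc θ f) pf

-- Here f(a) is the total weight of the parts read so far with sum a. Associativity of binomial sums
-- trades accumulation from the left for splitting off the next part x on the right.
foldl-addBlock : ∀ θs f n → foldl addBlock f θs n ≡ bsum n (λ a b → f a * admissibleSum θs a b)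
-- No parts remain, so the remainder must be zero.
foldl-addBlock []       f n = sym (trans
  (bsum-last n _ λ i j _ → *-zeroʳ (f i))
  (*-identityʳ (f n)))
foldl-addBlock (θ ∷ θs) f n = begin
  foldl addBlock (addBlock f θ) θs n
    ≡⟨ foldl-addBlock θs (addBlock f θ) n ⟩
  bsum n (λ c y → conv (trunc θ f) pf c * admissibleSum θs c y)
    ≡⟨ bsum-cong n (λ c y _ → trans
         (sym (bsum-*ʳ c _ (admissibleSum θs c y)))
         (bsum-cong c λ a x p →
           cong (λ c → trunc θ f a * pf x * admissibleSum θs c y) (sym p))) ⟩
  bsum n (λ c y → bsum c (λ a x → trunc θ f a * pf x * admissibleSum θs (a + x) y))
    ≡⟨ bsum-assoc n (λ a x y → trunc θ f a * pf x * admissibleSum θs (a + x) y) ⟩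
  bsum n (λ a b → bsum b (λ x y → trunc θ f a * pf x * admissibleSum θs (a + x) y))
    ≡⟨ bsum-cong n (λ a b _ → collect a b) ⟩
  bsum n (λ a b → f a * admissibleSum (θ ∷ θs) a b) ∎
  where
  rearrange : ∀ i f s → i * f * s ≡ f * (i * s)
  rearrange = solve-∀
  collect : ∀ a b → bsum b (λ x y → trunc θ f a * pf x * admissibleSum θs (a + x) y)
                    ≡ f a * admissibleSum (θ ∷ θs) a b
  collect a b = begin
    bsum b (λ x y → trunc θ f a * pf x * admissibleSum θs (a + x) y)
      ≡⟨ bsum-cong b (λ x y _ → *-assoc (trunc θ f a) (pf x) (admissibleSum θs (a + x) y)) ⟩
    bsum b (λ x y → trunc θ f a * (pf x * admissibleSum θs (a + x) y))
      ≡⟨ bsum-*ˡ b (trunc θ f a) _ ⟩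
    ind (θ ≤? a) * f a * bsum b (λ x y → pf x * admissibleSum θs (a + x) y)
      ≡⟨ rearrange (ind (θ ≤? a)) (f a) _ ⟩
    f a * (ind (θ ≤? a) * bsum b (λ x y → pf x * admissibleSum θs (a + x) y))
      ≡⟨ cong (f a *_) (admissibleSum-∷ θ θs a b) ⟨
    f a * admissibleSum (θ ∷ θs) a b ∎

-- t_j − j for the entries t_{q+1}, t_{q+2}, …
thresholds : ℕ → List ℕ → List ℕ
thresholds q []      = []
thresholds q (x ∷ t) = x ∸ suc q ∷ thresholds (suc q) t

length-thresholds : ∀ q t → length (thresholds q t) ≡ length t
length-thresholds q []      = refl
length-thresholds q (x ∷ t) = cong suc (length-thresholds (suc q) t)

thresholds-∷ʳ : ∀ q t x → thresholds q (t ∷ʳ x) ≡ thresholds q t ∷ʳ (x ∸ suc (q + length t))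
thresholds-∷ʳ q []      x = cong (λ r → x ∸ suc r ∷ []) (sym (+-identityʳ q))
thresholds-∷ʳ q (y ∷ t) x = cong (y ∸ suc q ∷_)
  (trans (thresholds-∷ʳ (suc q) t x)
    (cong (λ r → thresholds (suc q) t ∷ʳ (x ∸ suc r)) (sym (+-suc q (length t)))))

-- The right side of the inequalities in `InL` after q + 1 parts with sum `o` have been read; for q
-- = 0 and o = x it unfolds to the bound for `x ∷ ℓ`.
bound : ℕ → ℕ → List ℕ → ℕ → ℕ
bound q o ℓ j = o + sum (take j ℓ) + suc (q + j)

bound-zero : ∀ q o ℓ → bound q o ℓ 0 ≡ suc q + o
bound-zero q o ℓ = lem q o
  where
  lem : ∀ q o → o + 0 + suc (q + 0) ≡ suc q + o
  lem = solve-∀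

bound-[] : ∀ q o j → bound q o [] (suc j) ≡ bound (suc q) o [] j
bound-[] q o zero    = cong (λ r → o + 0 + suc r) (+-suc q 0)
bound-[] q o (suc j) = cong (λ r → o + 0 + suc r) (+-suc q (suc j))

bound-∷ : ∀ q o x ℓ j → bound q o (x ∷ ℓ) (suc j) ≡ bound (suc q) (o + x) ℓ j
bound-∷ q o x ℓ j = lem q o x (sum (take j ℓ)) j
  where
  lem : ∀ q o x s j → o + (x + s) + suc (q + suc j) ≡ o + x + s + suc (suc q + j)
  lem = solve-∀

-- Truncated subtraction does no harm: x ∸ (q + 1) ≤ o is equivalent to x ≤ (q + 1) + o.
InL⇒Admissible : ∀ {m} (t : Vec ℕ m) q o ℓ →
  (∀ j → lookup t j ≤ bound q o ℓ (toℕ j)) → Admissible (thresholds q (toList t)) o ℓ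
InL⇒Admissible Vec.[]      q o ℓ       le = tt
InL⇒Admissible (x Vec.∷ t) q o []      le =
  m≤n+o⇒m∸n≤o x (suc q) (subst (x ≤_) (bound-zero q o []) (le Fin.zero)) ,
  InL⇒Admissible t (suc q) o [] λ j → subst (lookup t j ≤_) (bound-[] q o (toℕ j)) (le (Fin.suc j))
InL⇒Admissible (x Vec.∷ t) q o (y ∷ ℓ) le =
  m≤n+o⇒m∸n≤o x (suc q) (subst (x ≤_) (bound-zero q o (y ∷ ℓ)) (le Fin.zero)) ,
  InL⇒Admissible t (suc q) (o + y) ℓ λ j →
    subst (lookup t j ≤_) (bound-∷ q o y ℓ (toℕ j)) (le (Fin.suc j))

Admissible⇒InL : ∀ {m} (t : Vec ℕ m) q o ℓ →
  Admissible (thresholds q (toList t)) o ℓ → ∀ j → lookup t j ≤ bound q o ℓ (toℕ j)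
Admissible⇒InL (x Vec.∷ t) q o [] (le , ad) Fin.zero =
  subst (x ≤_) (sym (bound-zero q o [])) (≤-trans (m≤n+m∸n x (suc q)) (+-monoʳ-≤ (suc q) le))
Admissible⇒InL (x Vec.∷ t) q o [] (le , ad) (Fin.suc j) =
  subst (lookup t j ≤_) (sym (bound-[] q o (toℕ j))) (Admissible⇒InL t (suc q) o [] ad j)
Admissible⇒InL (x Vec.∷ t) q o (y ∷ ℓ) (le , ad) Fin.zero =
  subst (x ≤_) (sym (bound-zero q o (y ∷ ℓ))) (≤-trans (m≤n+m∸n x (suc q)) (+-monoʳ-≤ (suc q) le))
Admissible⇒InL (x Vec.∷ t) q o (y ∷ ℓ) (le , ad) (Fin.suc j) =
  subst (lookup t j ≤_) (sym (bound-∷ q o y ℓ (toℕ j))) (Admissible⇒InL t (suc q) (o + y) ℓ ad j)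

-- The first part precedes every condition, so its weight `pf` is the starting function of the fold.
rhs≡foldl : ∀ n m (t : Vec ℕ m) → rhs n m t ≡ foldl addBlock pf (thresholds 0 (toList t)) (n ∸ m)
rhs≡foldl n m t = begin
  rhs n m t
    ≡⟨ sum-map-filter (inL? m t) _ (comps (suc m) (n ∸ m)) ⟩
  compSum (suc m) (n ∸ m) (ind ∘ inL? m t)
    ≡⟨ compSum-suc m (n ∸ m) _ ⟩
  bsum (n ∸ m) (λ x y → pf x * compSum m y (λ ℓ → ind (inL? m t (x ∷ ℓ))))
    ≡⟨ bsum-cong (n ∸ m) (λ x y _ → cong (pf x *_) (trans
         (compSum-cong m y (λ ℓ → ind-cong (mk⇔ (InL⇒Admissible t 0 x ℓ) (Admissible⇒InL t 0 x ℓ))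
                                           (inL? m t (x ∷ ℓ)) (admissible? θs x ℓ)))
         (cong (λ p → compSum p y (ind ∘ admissible? θs x)) (sym length-θs)))) ⟩
  bsum (n ∸ m) (λ x y → pf x * admissibleSum θs x y)
    ≡⟨ foldl-addBlock θs pf (n ∸ m) ⟨
  foldl addBlock pf θs (n ∸ m) ∎
  where
  θs : List ℕ
  θs = thresholds 0 (toList t)
  length-θs : length θs ≡ m
  length-θs = trans (length-thresholds 0 (toList t)) (length-toList t)

-- Adding the spots one by one

-- In a strictly increasing list k + 1 occurs once and after all smaller entries.
filter-≤-suc-∈ : ∀ {k t} → AllPairs _<_ t → suc k ∈ t → filter (_≤? suc k) t ≡ filter (_≤? k) t ∷ʳ suc k
filter-≤-suc-∈ {k} {x ∷ t} (x<t ∷ _) (here refl) = begin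
  filter (_≤? suc k) (suc k ∷ t)      ≡⟨ filter-accept (_≤? suc k) ≤-refl ⟩
  suc k ∷ filter (_≤? suc k) t        ≡⟨ cong (suc k ∷_) (filter-none (_≤? suc k) (All.map <⇒≱ x<t)) ⟩
  suc k ∷ []                          ≡⟨ cong (_∷ʳ suc k) (filter-none (_≤? k) (All.map (<⇒≱ ∘ <-trans (n<1+n k)) x<t)) ⟨
  filter (_≤? k) t ∷ʳ suc k           ≡⟨ cong (_∷ʳ suc k) (filter-reject (_≤? k) {suc k} {t} (<⇒≱ (n<1+n k))) ⟨
  filter (_≤? k) (suc k ∷ t) ∷ʳ suc k ∎
filter-≤-suc-∈ {k} {x ∷ t} (x<t ∷ st) (there k∈t) = begin
  filter (_≤? suc k) (x ∷ t)          ≡⟨ filter-accept (_≤? suc k) (<⇒≤ x<1+k) ⟩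
  x ∷ filter (_≤? suc k) t            ≡⟨ cong (x ∷_) (filter-≤-suc-∈ st k∈t) ⟩
  x ∷ filter (_≤? k) t ∷ʳ suc k       ≡⟨ cong (_∷ʳ suc k) (filter-accept (_≤? k) {x} {t} (s≤s⁻¹ x<1+k)) ⟨
  filter (_≤? k) (x ∷ t) ∷ʳ suc k     ∎
  where
  x<1+k : x < suc k
  x<1+k = All.lookup x<t k∈t

filter-≤-suc-∉ : ∀ {k} t → suc k ∉ t → filter (_≤? suc k) t ≡ filter (_≤? k) t
filter-≤-suc-∉ []      _   = refl
filter-≤-suc-∉ {k} (x ∷ t) k∉t with <-cmp x (suc k)
... | tri≈ _ refl _ = contradiction (here refl) k∉t
... | tri< x<1+k _ _ = trans (filter-accept (_≤? suc k) (<⇒≤ x<1+k))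
  (trans (cong (x ∷_) (filter-≤-suc-∉ t (k∉t ∘ there))) (sym (filter-accept (_≤? k) (s≤s⁻¹ x<1+k))))
... | tri> _ _ 1+k<x = trans (filter-reject (_≤? suc k) (<⇒≱ 1+k<x))
  (trans (filter-≤-suc-∉ t (k∉t ∘ there)) (sym (filter-reject (_≤? k) (<⇒≱ (<-trans (n<1+n k) 1+k<x)))))

module _ {t : List ℕ} (t-sorted : AllPairs _<_ t) where

  taken : ℕ → List ℕ
  taken k = filter (_≤? k) t

  -- The function f of the expansion once the spots in [k] have been added.
  blocks : ℕ → ℕ → ℕ
  blocks k = foldl addBlock pf (thresholds 0 (taken k))

  taken+free : All (1 ≤_) t → ∀ k → length (taken k) + #free t k ≡ k
  taken+free 1≤t zero = cong (λ l → length l + 0) (filter-none (_≤? 0) (All.map <⇒≱ 1≤t))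
  taken+free 1≤t (suc k) with suc k ∈? t
  ... | yes k∈t = trans
    (cong₂ (λ u v → length u + length v) (filter-≤-suc-∈ t-sorted k∈t) (freeSpots-∈ t k∈t))
    (trans (cong (_+ #free t k) (trans (length-++ (taken k)) (+-comm (length (taken k)) 1)))
      (cong suc (taken+free 1≤t k)))
  ... | no k∉t = trans
    (cong₂ (λ u v → length u + length v) (filter-≤-suc-∉ t k∉t) (freeSpots-∉ t k∉t))
    (trans (cong₂ _+_ refl (trans (length-++ (freeSpots k t)) (+-comm (#free t k) 1)))
      (trans (+-suc (length (taken k)) (#free t k)) (cong suc (taken+free 1≤t k))))

  counts : All (1 ≤_) t → ∀ k → Counts (#free t k) (blocks k) (#accepted t k)
  counts 1≤t zero = subst (λ l → Counts 0 (foldl addBlock pf (thresholds 0 l)) (#accepted t 0))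
    (sym (filter-none (_≤? 0) (All.map <⇒≱ 1≤t)))
    (counts-cong (λ n → sym (#accepted-zero t n)) counts-empty)
  counts 1≤t (suc k) with suc k ∈? t
  ... | yes k∈t = counts-cong (λ n → sym (#accepted-suc t k n))
    (subst₂ (λ b f → Counts b f (addSpot b (#accepted t k)))
      (cong length (sym (freeSpots-∈ t k∈t))) (sym blocks-suc) (counts-taken (counts 1≤t k)))
    where
    blocks-suc : blocks (suc k) ≡ addBlock (blocks k) (#free t k)
    blocks-suc = begin
      foldl addBlock pf (thresholds 0 (taken (suc k)))
        ≡⟨ cong (foldl addBlock pf) (trans
             (cong (thresholds 0) (filter-≤-suc-∈ t-sorted k∈t)) (thresholds-∷ʳ 0 (taken k) (suc k))) ⟩
      foldl addBlock pf (thresholds 0 (taken k) ∷ʳ (k ∸ length (taken k)))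
        ≡⟨ foldl-∷ʳ addBlock pf _ (thresholds 0 (taken k)) ⟩
      addBlock (blocks k) (k ∸ length (taken k))
        -- If k + 1 is the taken spot with index j + 1, its threshold is k - j. Since [k] holds j
        -- taken spots, this is its number of free spots, the truncation point in `counts-taken`.
        ≡⟨ cong (λ j → addBlock (blocks k) (j ∸ length (taken k))) (taken+free 1≤t k) ⟨
      addBlock (blocks k) (length (taken k) + #free t k ∸ length (taken k))
        ≡⟨ cong (addBlock (blocks k)) (m+n∸m≡n (length (taken k)) (#free t k)) ⟩
      addBlock (blocks k) (#free t k) ∎
  ... | no k∉t = counts-cong (λ n → sym (#accepted-suc t k n))
    (subst₂ (λ b l → Counts b (foldl addBlock pf (thresholds 0 l)) (addSpot b (#accepted t k)))
      (sym (trans (cong length (freeSpots-∉ t k∉t))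
        (trans (length-++ (freeSpots k t)) (+-comm (#free t k) 1))))
      (sym (filter-≤-suc-∉ t k∉t)) (counts-free (counts 1≤t k)))

theorem1p1 : (n m : ℕ) (t : Vec ℕ m)
    → Linked _<_ (toList t)
    → All (λ x → 1 ≤ x × x ≤ n) (toList t)
    → length (PC n m t) ≡ rhs n m t
theorem1p1 n m t lt bd = begin
  length (filter (isPC? n t′) (seqs n (n ∸ m)))
    ≡⟨ cong (λ N → length (filter (isPC? n t′) (seqs n N))) free ⟨
  length (filter (isPC? n t′) (seqs n (#free t′ n)))
    ≡⟨ #PC t′ n ⟩
  #accepted t′ n (#free t′ n)
    -- A completion has exactly as many entries as there are free spots, so the expansion is needed
    -- only on its diagonal.
    ≡⟨ counts-diagonal (counts sorted 1≤t n) ⟩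
  blocks sorted n (#free t′ n)
    ≡⟨ cong₂ (λ l N → foldl addBlock pf (thresholds 0 l) N) taken-all free ⟩
  foldl addBlock pf (thresholds 0 t′) (n ∸ m)
    ≡⟨ rhs≡foldl n m t ⟨
  rhs n m t ∎
  where
  t′ : List ℕ
  t′ = toList t
  sorted : AllPairs _<_ t′
  sorted = Linked⇒AllPairs <-trans lt
  1≤t : All (1 ≤_) t′
  1≤t = All.map proj₁ bd
  taken-all : taken sorted n ≡ t′
  taken-all = filter-all (_≤? n) (All.map proj₂ bd)
  free : #free t′ n ≡ n ∸ m
  free = begin
    #free t′ n          ≡⟨ m+n∸m≡n m (#free t′ n) ⟨
    m + #free t′ n ∸ m  ≡⟨ cong (λ p → p + #free t′ n ∸ m) (trans (cong length taken-all) (length-toList t)) ⟨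
    length (taken sorted n) + #free t′ n ∸ m ≡⟨ cong (_∸ m) (taken+free sorted 1≤t n) ⟩
    n ∸ m           ∎
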